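{- For every two-way linear $\mathrm{HTA}_\pm$ $\mathcal{A}=\langle Q,\Sigma,\delta,q_I,F\rangle$ over $\Sigma=2^{AP}$ there is a $\mathrm{PastCTL}_\pm$ formula $\varphi_{\mathcal{A}}$ such that $\mathcal{L}(\mathcal{A})=\mathcal{L}(\varphi_{\mathcal{A}})$.
   Context: Fix a finite set $AP$, $\Sigma=2^{AP}$. A $\Sigma$-tree is an unranked (finitely many children per node), unordered, leafless (every node has a child) tree with labelling $t(v)\in\Sigma$. $\mathrm{PastCTL}_\pm$ formulae: $\varphi ::= p\mid\neg\varphi\mid\varphi\lor\varphi\mid\mathsf{D}^n\varphi\mid\mathsf{E}\mathsf{X}\varphi\mid\mathsf{E}(\varphi\,\mathsf{U}\,\varphi)\mid\mathsf{E}\mathsf{Y}\varphi\mid\mathsf{E}(\varphi\,\mathsf{S}\,\varphi)$, evaluated at a node $u$ of $t$: $p$ iff $p\in t(u)$; Booleans as usual; $\mathsf{D}^n\varphi$ iff $u$ has at least $n$ distinct children satisfying $\varphi$; $\mathsf{E}\mathsf{X}\varphi$ iff some child of $u$ satisfies $\varphi$; $\mathsf{E}(\varphi_1\mathsf{U}\varphi_2)$ iff there is a path $u=v_0,v_1,\dots,v_j$ ($j\ge0$, each $v_{k+1}$ a child of $v_k$) with $v_j\models\varphi_2$ and $v_k\models\varphi_1$ for $k<j$; $\mathsf{E}\mathsf{Y}\varphi$ iff $u$ is not the root and its parent satisfies $\varphi$; $\mathsf{E}(\varphi_1\mathsf{S}\varphi_2)$ iff there is $j\ge0$ such that, writing $w_0=u$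 and $w_{k+1}$ the parent of $w_k$ (all existing), $w_j\models\varphi_2$ and $w_k\models\varphi_1$ for $k<j$. $\mathcal{L}(\varphi)$ is the set of trees whose root satisfies $\varphi$. Positive Boolean formulae $\mathcal{B}^+(X)$: built from $\top,\bot$ and elements of $X$ by $\land,\lor$. A two-way $\mathrm{HTA}_\pm$ is $\mathcal{A}=\langle Q,\Sigma,\delta,q_I,F\rangle$ with $Q$ finite, $q_I\in Q$, $F\subseteq Q$ and $\delta:Q\times\Sigma\times\{\mathit{root},\mathit{nonroot}\}\to\mathcal{B}^+(\{\Diamond_k,\Box_k\}_{k\in\mathbb{N}}\times Q\ \cup\ \{\Uparrow\}\times Q)$; write $\Diamond=\Diamond_1$, $\Box=\Box_1$. A run on $t$ from node $s$ is a tree $r$ labelled by $Q\times\mathrm{Dom}(t)$ whose root is labelled $(q_I,s)$ and each node $x$ labelled $(q,v)$ satisfies $\delta(q,t(v),\rho)$, $\rho=\mathit{root}$ iff $v$ is the root of $t$, where: $x\models(\Diamond_k,q')$ iff $x$ has children labelled $(q',v_1),\dots,(q',v_k)$ with $v_1,\dots,v_k$ pairwise distinct children of $v$; $x\models(\Box_k,q')$ iff for all but at most $k-1$ children $v'$ of $v$, $x$ has a child labelled $(q',v')$; $x\models(\Uparrow,q')$ iff $x$ has a child labelled $(q',v')$ with $v'$ the parent of $v$ in $t$; $\top,\bot,\land,\lor$ as usual. A run is accepting if every infinite path in $r$ from its root has infinitely many nodes with state in $F$. $\mathcal{L}(\mathcal{A})$ is the set of trees with an accepting run from the root. Hesitant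 structure: $Q$ is partitioned into nonempty components $Q_1,\dots,Q_n$, totally ordered so that if $q\in Q_i$ and $q'\in Q_j$ occurs in an atom of some $\delta(q,\sigma,\rho)$ then $j\le i$; each component is of exactly one type (a $Q_i$-atom is an atom whose state is in $Q_i$): transient (no $Q_i$-atom in $\delta(q,\sigma,\rho)$ for $q\in Q_i$); existential (all such $Q_i$-atoms have the form $(\Diamond,q')$ and each clause of the disjunctive normal form of $\delta(q,\sigma,\rho)$ has at most one $Q_i$-atom); universal (all such $Q_i$-atoms have the form $(\Box,q')$ and each clause of the conjunctive normal form has at most one $Q_i$-atom); upward (for a singleton $\{q\}$: $q$ occurs in $\delta(q,\sigma,\rho)$ only in atoms $(\Uparrow,q)$). Polarised: states of existential components are not in $F$ and states of universal components are in $F$. Linear: every component is a singleton.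
   Formalization: The finite set AP is assumed nonempty: for AP = ∅ the grammar, whose only base case is p ∈ AP, generates no formula at all, so the claim fails as literally stated. -}

module Defs where

open import Data.Empty using (⊥)
open import Data.Fin using (Fin; zero; suc; fromℕ; inject₁)
import Data.Fin as Fin
open import Data.Fin.Subset using (Subset; _∈_; _∉_)
open import Data.List using (List; []; _∷_; _++_; length; cartesianProductWith)
import Data.List.Membership.Propositional as List
open import Data.Maybe using (Maybe; just; nothing)
open import Data.Nat using (ℕ; zero; suc; _≤_; _<_)
open import Data.Product using (Σ; ∃; _×_; _,_; proj₁; proj₂)
open import Data.Sum using (_⊎_)
open import Data.Unit using (⊤)
open import Function using (flip)
open import Function.Bundles using (_⇔_)
open import Function.Definitions using (Injective; StrictlySurjective)
open import Level using (0ℓ) renaming (suc to lsuc)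
open import Relation.Binary.Construct.Closure.ReflexiveTransitive using (Star)
open import Relation.Binary.PropositionalEquality using (_≡_)
open import Relation.Nullary using (¬_)
open import Relation.Unary using (Pred)

-- A rooted tree of arbitrary (possibly infinite) branching.  By ascent, the
-- root is the only node without a parent, and no ancestor chain is infinite.
record RootedTree : Set₁ where
  field
    Node        : Set
    root        : Node
    parent      : Node → Maybe Node
    parent-root : parent root ≡ nothing

  Child : Node → Node → Set
  Child v v′ = parent v′ ≡ just v

  field
    ascent : ∀ v → Star (flip Child) v root

-- Σ-trees for Σ = 2^AP, with AP = Fin a and letters the subsets of AP.
-- The list in finitelyBranching only witnesses finiteness of the set of
-- children; nothing below refers to its order.
record ΣTree (a : ℕ) : Set₁ where
  field
    rootedTree : RootedTree

  open RootedTree rootedTree public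

  field
    label             : Node → Subset a
    finitelyBranching : ∀ v → ∃ λ vs → ∀ v′ → Child v v′ ⇔ v′ List.∈ vs
    leafless          : ∀ v → ∃ λ v′ → Child v v′

data PastCTL± (a : ℕ) : Set where
  var  : Fin a → PastCTL± a
  not  : PastCTL± a → PastCTL± a
  _or_ : PastCTL± a → PastCTL± a → PastCTL± a
  D    : ℕ → PastCTL± a → PastCTL± a
  EX   : PastCTL± a → PastCTL± a
  E_U_ : PastCTL± a → PastCTL± a → PastCTL± a
  EY   : PastCTL± a → PastCTL± a
  E_S_ : PastCTL± a → PastCTL± a → PastCTL± a

AtLeast : {A : Set} → ℕ → Pred A 0ℓ → Set
AtLeast {A} n P =
  Σ (Fin n → A) λ w → Injective _≡_ _≡_ w × (∀ i → P (w i))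

-- There is a sequence u = v₀ , … , vⱼ, each step in R, with Q at vⱼ and P at
-- every vₖ with k < j.
PathUntil : {A : Set} → (A → A → Set) → Pred A 0ℓ → Pred A 0ℓ → Pred A 0ℓ
PathUntil {A} R P Q u =
  ∃ λ j → Σ (Fin (suc j) → A) λ v →
    v zero ≡ u
    × (∀ (k : Fin j) → R (v (inject₁ k)) (v (suc k)))
    × Q (v (fromℕ j))
    × (∀ (k : Fin j) → P (v (inject₁ k)))

module _ {a : ℕ} (t : ΣTree a) where
  open ΣTree t

  Sat : PastCTL± a → Pred Node 0ℓ
  Sat (var p)   u = p ∈ label u
  Sat (not φ)   u = ¬ Sat φ u
  Sat (φ or ψ)  u = Sat φ u ⊎ Sat ψ u
  Sat (D n φ)   u = AtLeast n (λ v → Child u v × Sat φ v)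
  Sat (EX φ)    u = ∃ λ v → Child u v × Sat φ v
  Sat (E φ U ψ) u = PathUntil Child (Sat φ) (Sat ψ) u
  Sat (EY φ)    u = ∃ λ v → Child v u × Sat φ v
  Sat (E φ S ψ) u = PathUntil (flip Child) (Sat φ) (Sat ψ) u

L-formula : {a : ℕ} → PastCTL± a → Pred (ΣTree a) 0ℓ
L-formula φ t = Sat t φ (ΣTree.root t)

data B⁺ (X : Set) : Set where
  tt ff   : B⁺ X
  atom    : X → B⁺ X
  _∧_ _∨_ : B⁺ X → B⁺ X → B⁺ X

module _ {X : Set} where

  eval : Pred X 0ℓ → B⁺ X → Set
  eval V tt       = ⊤
  eval V ff       = ⊥
  eval V (atom x) = V x
  eval V (θ ∧ η)  = eval V θ × eval V η
  eval V (θ ∨ η)  = eval V θ ⊎ eval V η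

  _OccursIn_ : X → B⁺ X → Set
  x OccursIn tt       = ⊥
  x OccursIn ff       = ⊥
  x OccursIn (atom y) = x ≡ y
  x OccursIn (θ ∧ η)  = x OccursIn θ ⊎ x OccursIn η
  x OccursIn (θ ∨ η)  = x OccursIn θ ⊎ x OccursIn η

  dnf : B⁺ X → List (List X)
  dnf tt       = [] ∷ []
  dnf ff       = []
  dnf (atom x) = (x ∷ []) ∷ []
  dnf (θ ∧ η)  = cartesianProductWith _++_ (dnf θ) (dnf η)
  dnf (θ ∨ η)  = dnf θ ++ dnf η

  cnf : B⁺ X → List (List X)
  cnf tt       = []
  cnf ff       = [] ∷ []
  cnf (atom x) = (x ∷ []) ∷ []
  cnf (θ ∧ η)  = cnf θ ++ cnf η
  cnf (θ ∨ η)  = cartesianProductWith _++_ (cnf θ) (cnf η)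

  -- Clauses are read as sets of atoms: a repeated atom counts once.
  AtMostOne : Pred X 0ℓ → List X → Set
  AtMostOne P C = ∀ x y → x List.∈ C → y List.∈ C → P x → P y → x ≡ y

data Atom (Q : Set) : Set where
  ◇ □ : ℕ → Q → Atom Q
  ⇑   : Q → Atom Q

stateOf : {Q : Set} → Atom Q → Q
stateOf (◇ _ q) = q
stateOf (□ _ q) = q
stateOf (⇑ q)   = q

data Position : Set where
  atRoot nonRoot : Position

-- A node is the root exactly when it has no parent.
position : (t : RootedTree) → RootedTree.Node t → Position
position t v with RootedTree.parent t v
... | nothing = atRoot
... | just _  = nonRoot

data Kind : Set where
  transient existential universal upward : Kind

record TwoWayAutomaton (a : ℕ) : Set where
  field
    #Q : ℕ

  State : Set
  State = Fin #Q

  field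
    δ  : State → Subset a → Position → B⁺ (Atom State)
    qI : State
    F  : Subset #Q

module _ {a : ℕ} (A : TwoWayAutomaton a) {n : ℕ}
         (component : TwoWayAutomaton.State A → Fin n) where
  open TwoWayAutomaton A

  InComponent : Fin n → Pred (Atom State) 0ℓ
  InComponent i α = component (stateOf α) ≡ i

  OfKind : Kind → Fin n → Set
  OfKind transient i =
    ∀ q σ ρ → component q ≡ i →
      ∀ α → α OccursIn δ q σ ρ → ¬ InComponent i α
  OfKind existential i =
    ∀ q σ ρ → component q ≡ i →
      (∀ α → α OccursIn δ q σ ρ → InComponent i α → α ≡ ◇ 1 (stateOf α))
      × (∀ C → C List.∈ dnf (δ q σ ρ) → AtMostOne (InComponent i) C)
  OfKind universal i =
    ∀ q σ ρ → component q ≡ i →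
      (∀ α → α OccursIn δ q σ ρ → InComponent i α → α ≡ □ 1 (stateOf α))
      × (∀ C → C List.∈ cnf (δ q σ ρ) → AtMostOne (InComponent i) C)
  OfKind upward i =
    ∃ λ q → (∀ q′ → component q′ ≡ i ⇔ q′ ≡ q)
      × (∀ σ ρ α → α OccursIn δ q σ ρ → stateOf α ≡ q → α ≡ ⇑ q)

-- ± stands for "polarised".  A component without atoms of its own meets the
-- conditions of several kinds, so "exactly one type" is rendered as an
-- assignment of a kind to each component; polarisation refers to the assigned
-- kind.
record HTA± (a : ℕ) : Set where
  field
    automaton : TwoWayAutomaton a

  open TwoWayAutomaton automaton public

  field
    #components   : ℕ
    component     : State → Fin #components
    nonempty      : StrictlySurjective _≡_ component
    ordered       : ∀ q σ ρ α → α OccursIn δ q σ ρ →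
                    component (stateOf α) Fin.≤ component q
    kind          : Fin #components → Kind
    hesitant      : ∀ i → OfKind automaton component (kind i) i
    existential∉F : ∀ q → kind (component q) ≡ existential → q ∉ F
    universal∈F   : ∀ q → kind (component q) ≡ universal → q ∈ F

Linear : {a : ℕ} → HTA± a → Set
Linear A = Injective _≡_ _≡_ (HTA±.component A)

module _ {a : ℕ} (A : HTA± a) (t : ΣTree a) where
  open HTA± A
  private module t = ΣTree t

  module _ (r : RootedTree) (lab : RootedTree.Node r → State × t.Node) where
    private module r = RootedTree r

    HasChild : r.Node → State → t.Node → Set
    HasChild x q v = ∃ λ y → r.Child x y × lab y ≡ (q , v)

    -- "All but at most k - 1" children: fewer than k exceptions, so that
    -- □₀ is unsatisfiable, dually to ◇₀, which always holds.
    AtomSat : r.Node → t.Node → Pred (Atom State) 0ℓ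
    AtomSat x v (◇ k q) = AtLeast k (λ v′ → t.Child v v′ × HasChild x q v′)
    AtomSat x v (□ k q) =
      ∃ λ exceptions → length exceptions < k
        × (∀ v′ → t.Child v v′ → ¬ (v′ List.∈ exceptions) → HasChild x q v′)
    AtomSat x v (⇑ q)   = ∃ λ v′ → t.Child v′ v × HasChild x q v′

  record Run (s : t.Node) : Set₁ where
    field
      tree : RootedTree

    open RootedTree tree public

    field
      runLabel   : Node → State × t.Node
      rootLabel  : runLabel root ≡ (qI , s)
      consistent : ∀ x → let (q , v) = runLabel x in
                   eval (AtomSat tree runLabel x v)
                        (δ q (t.label v) (position t.rootedTree v))

  Accepting : {s : t.Node} → Run s → Set
  Accepting r =
    (π : ℕ → Node) → π 0 ≡ root → (∀ n → Child (π n) (π (suc n))) →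
    ∀ n → ∃ λ m → n ≤ m × proj₁ (runLabel (π m)) ∈ F
    where open Run r

L-automaton : {a : ℕ} → HTA± a → Pred (ΣTree a) (lsuc 0ℓ)
L-automaton A t = Σ (Run A t (ΣTree.root t)) (Accepting A t)

{-# OPTIONS --safe #-}

-- Since components are singletons, all atoms of δ(q,σ,ρ) about q itself are
-- equal, say to α, so δ(q,σ,ρ) is equivalent to δ[⊥] ∨ (δ[⊤] ∧ α), where [β]
-- substitutes β for α.  The remaining atoms concern states of smaller
-- components, hence are expressible by induction, and acceptance selects the
-- fixpoint of X ↦ δ[⊥] ∨ (δ[⊤] ∧ αX):  E(δ[⊤] U δ[⊥]) for existential q,
-- ¬E(¬δ[⊥] U ¬δ[⊤]) for universal q, and E(δ[⊤] S δ[⊥]) for upward q, where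
-- all fixpoints coincide because no ancestor chain is infinite.
module Submission where

open import Defs
open import Axiom.ExcludedMiddle using (ExcludedMiddle)
open import Data.Bool using (true; false)
open import Data.Empty using (⊥; ⊥-elim)
open import Data.Fin using (Fin; zero; suc; fromℕ; inject₁; toℕ)
open import Data.Fin.Properties using (_≟_; toℕ-injective; toℕ<n; pigeonhole; <⇒≢)
open import Data.Fin.Subset using (Subset; _∈_; inside; outside)
open import Data.List using (List; []; _∷_; length; tabulate) renaming (lookup to lookupₗ)
open import Data.List.Membership.Propositional using () renaming (_∈_ to _∈ₗ_)
open import Data.List.Membership.Propositional.Properties using (∈-tabulate⁺)
open import Data.List.Properties using (length-tabulate)
open import Data.List.Relation.Unary.Any using (index)
open import Data.List.Relation.Unary.Any.Properties using (lookup-index)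
open import Data.Maybe using (Maybe; just; nothing)
open import Data.Nat using (ℕ; zero; suc; _+_; _≤_; _<_; z≤n; s≤s; s≤s⁻¹; NonZero)
open import Data.Nat.Induction using (<-wellFounded)
open import Data.Nat.Properties using (≤∧≢⇒<; <-≤-trans; n<1+n; n≤1+n; ≤-reflexive; m≤m+n; +-suc)
open import Data.Product using (∃; Σ; _×_; _,_; proj₁; proj₂; map₂)
open import Data.Product.Relation.Binary.Lex.Strict using (×-Lex; ×-wellFounded)
open import Data.Sum using (_⊎_; inj₁; inj₂) renaming (map to map-⊎)
open import Data.Unit using () renaming (tt to ∗)
open import Data.Vec using ([]; _∷_; lookup) renaming (tabulate to tabulateᵛ)
open import Data.Vec.Properties using (lookup⇒[]=; []=⇒lookup; tabulate∘lookup)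
open import Function using (_∘_; id; flip)
open import Function.Bundles using (_⇔_; mk⇔; Equivalence)
open import Function.Construct.Composition using (_⇔-∘_)
open import Induction.WellFounded using (Acc; acc; WellFounded)
open import Level using (0ℓ)
open import Relation.Binary.Construct.Closure.ReflexiveTransitive using (Star; ε; _◅_)
open import Relation.Binary.PropositionalEquality using (_≡_; _≢_; refl; sym; trans; cong; subst)
open import Relation.Nullary using (¬_; yes; no; contradiction)
open import Relation.Nullary.Decidable using (decidable-stable)
open import Relation.Unary using (Pred; _≐_)

open Equivalence using (to; from)

private
  variable
    X : Set

-- Positive Boolean formulae

eval-mono : {V W : Pred X 0ℓ} (θ : B⁺ X) →
            (∀ x → x OccursIn θ → V x → W x) → eval V θ → eval W θ
eval-mono tt       f e        = e
eval-mono (atom x) f e        = f x refl e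
eval-mono (θ ∧ η)  f (e , e′) =
  eval-mono θ (λ x → f x ∘ inj₁) e , eval-mono η (λ x → f x ∘ inj₂) e′
eval-mono (θ ∨ η)  f (inj₁ e) = inj₁ (eval-mono θ (λ x → f x ∘ inj₁) e)
eval-mono (θ ∨ η)  f (inj₂ e) = inj₂ (eval-mono η (λ x → f x ∘ inj₂) e)

-- Either all atoms that a derivation of `eval V θ` uses go to `W`, or one of them goes to `R`. With
-- `R` holding of self atoms, this becomes the choice between `δ⊥` and a further step in the same
-- state.
eval-mono-or-occurs : {V W R : Pred X 0ℓ} (θ : B⁺ X) →
  (∀ x → x OccursIn θ → V x → W x ⊎ R x) → eval V θ →
  eval W θ ⊎ ∃ λ x → x OccursIn θ × R x
eval-mono-or-occurs tt       f e = inj₁ e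
eval-mono-or-occurs (atom x) f e = map-⊎ id (λ r → x , refl , r) (f x refl e)
eval-mono-or-occurs (θ ∧ η)  f (e , e′)
  with eval-mono-or-occurs θ (λ x → f x ∘ inj₁) e
     | eval-mono-or-occurs η (λ x → f x ∘ inj₂) e′
... | inj₁ w           | inj₁ w′          = inj₁ (w , w′)
... | inj₂ (x , o , r) | _                = inj₂ (x , inj₁ o , r)
... | inj₁ _           | inj₂ (x , o , r) = inj₂ (x , inj₂ o , r)
eval-mono-or-occurs (θ ∨ η)  f (inj₁ e) =
  map-⊎ inj₁ (λ (x , o , r) → x , inj₁ o , r)
    (eval-mono-or-occurs θ (λ x → f x ∘ inj₁) e)
eval-mono-or-occurs (θ ∨ η)  f (inj₂ e) =
  map-⊎ inj₂ (λ (x , o , r) → x , inj₂ o , r)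
    (eval-mono-or-occurs η (λ x → f x ∘ inj₂) e)

-- Counting

AtLeast-mono : {P Q : Pred X 0ℓ} {k : ℕ} →
               (∀ x → P x → Q x) → AtLeast k P → AtLeast k Q
AtLeast-mono f (w , inj , p) = w , inj , λ i → f (w i) (p i)

AtLeast-suc : {P : Pred X 0ℓ} {k : ℕ} {x : X} ((w , _) : AtLeast k P) →
              P x → (∀ i → x ≢ w i) → AtLeast (suc k) P
AtLeast-suc {X} {P} {k} {x} (w , inj , p) px x∉w = w′ , inj′ , p′
  where
  w′ : Fin (suc k) → X
  w′ zero    = x
  w′ (suc i) = w i

  inj′ : ∀ {i j} → w′ i ≡ w′ j → i ≡ j
  inj′ {zero}  {zero}  _  = refl
  inj′ {zero}  {suc j} eq = contradiction eq (x∉w j)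
  inj′ {suc i} {zero}  eq = contradiction (sym eq) (x∉w i)
  inj′ {suc i} {suc j} eq = cong suc (inj eq)

  p′ : ∀ i → P (w′ i)
  p′ zero    = px
  p′ (suc i) = p i

listed⇒¬AtLeast : {P : Pred X 0ℓ} {k : ℕ} (xs : List X) → length xs < k →
                  (∀ x → P x → x ∈ₗ xs) → ¬ AtLeast k P
listed⇒¬AtLeast xs xs<k P⊆xs (w , inj , p)
  with i , j , i<j , eq ← pigeonhole xs<k (λ i → index (P⊆xs (w i) (p i))) =
  <⇒≢ i<j (inj (trans (lookup-index (P⊆xs (w i) (p i)))
    (trans (cong (lookupₗ xs) eq) (sym (lookup-index (P⊆xs (w j) (p j)))))))

-- If `AtLeast k P` fails too, the recursion applies. Otherwise its `k` witnesses already list all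
-- of `P`, because an unlisted element would extend them to `suc k`.
¬AtLeast⇒listed : ExcludedMiddle 0ℓ → {P : Pred X 0ℓ} (k : ℕ) →
                  ¬ AtLeast k P →
                  ∃ λ xs → length xs < k × (∀ x → P x → x ∈ₗ xs)
¬AtLeast⇒listed em zero    few = contradiction ((λ ()) , (λ { {()} }) , λ ()) few
¬AtLeast⇒listed em {P} (suc k) few with em {AtLeast k P}
... | no fewer with xs , xs<k , P⊆xs ← ¬AtLeast⇒listed em k fewer =
  xs , <-≤-trans xs<k (n≤1+n k) , P⊆xs
... | yes many@(w , _) =
  tabulate w , s≤s (≤-reflexive (length-tabulate w)) , λ x px →
    decidable-stable em λ x∉ →
      few (AtLeast-suc {P = P} many px λ { i refl → x∉ (∈-tabulate⁺ i) })

-- Paths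

-- `PathUntil` by recursion on its number of steps. The exposed number later serves as the rank that
-- decreases along a run.
UntilAfter : (X → X → Set) → Pred X 0ℓ → Pred X 0ℓ → ℕ → Pred X 0ℓ
UntilAfter R P Q zero    u = Q u
UntilAfter R P Q (suc j) u = P u × ∃ λ v → R u v × UntilAfter R P Q j v

module _ (R : X → X → Set) (P Q : Pred X 0ℓ) where

  pathUntil⇒after : ∀ {u} → PathUntil R P Q u → ∃ λ j → UntilAfter R P Q j u
  pathUntil⇒after (j , v , refl , steps , q , p) = j , go j v steps q p
    where
    go : ∀ j (v : Fin (suc j) → X) →
         (∀ (k : Fin j) → R (v (inject₁ k)) (v (suc k))) → Q (v (fromℕ j)) →
         (∀ (k : Fin j) → P (v (inject₁ k))) → UntilAfter R P Q j (v zero)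
    go zero    v steps q p = q
    go (suc j) v steps q p =
      p zero , v (suc zero) , steps zero , go j (v ∘ suc) (steps ∘ suc) q (p ∘ suc)

  pathUntil-here : ∀ {u} → Q u → PathUntil R P Q u
  pathUntil-here {u} q = 0 , (λ _ → u) , refl , (λ ()) , q , λ ()

  pathUntil-there : ∀ {u v} → P u → R u v → PathUntil R P Q v → PathUntil R P Q u
  pathUntil-there {u} p s (j , v , refl , steps , q , ps) =
    suc j , (λ { zero → u ; (suc k) → v k }) , refl ,
    (λ { zero → s ; (suc k) → steps k }) , q , λ { zero → p ; (suc k) → ps k }

-- Derived connectives

module Connectives {a : ℕ} (p₀ : Fin a) where

  -- The syntax has no constants, so truth is excluded middle at some proposition `p₀`.
  trueᶠ falseᶠ : PastCTL± a
  trueᶠ  = var p₀ or not (var p₀)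
  falseᶠ = not trueᶠ

  _and_ : PastCTL± a → PastCTL± a → PastCTL± a
  φ and ψ = not (not φ or not ψ)

  ite : PastCTL± a → PastCTL± a → PastCTL± a → PastCTL± a
  ite φ ψ χ = (φ and ψ) or (not φ and χ)

  -- A decision tree that makes the letter an argument of `f`: `ι` gives the propositions still to
  -- be read, and the answers to the earlier ones are absorbed into `f`.
  caseLabel : ∀ {m} → (Fin m → Fin a) → (Subset m → PastCTL± a) → PastCTL± a
  caseLabel {zero}  ι f = f []
  caseLabel {suc m} ι f =
    ite (var (ι zero)) (caseLabel (ι ∘ suc) (f ∘ (inside ∷_)))
                       (caseLabel (ι ∘ suc) (f ∘ (outside ∷_)))

  caseNode : (Subset a → Position → PastCTL± a) → PastCTL± a
  caseNode f = caseLabel id λ σ → ite (EY trueᶠ) (f σ nonRoot) (f σ atRoot)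

  modal : Atom X → PastCTL± a → PastCTL± a
  modal (◇ k _) φ = D k φ
  modal (□ k _) φ = not (D k (not φ))
  modal (⇑ _)   φ = EY φ

  interpret : (X → PastCTL± a) → B⁺ X → PastCTL± a
  interpret g tt       = trueᶠ
  interpret g ff       = falseᶠ
  interpret g (atom x) = g x
  interpret g (θ ∧ η)  = interpret g θ and interpret g η
  interpret g (θ ∨ η)  = interpret g θ or interpret g η

-- `AtomSat` with an arbitrary predicate in place of `HasChild`. Satisfaction of a formula, labels
-- of children in a run and successors of a configuration are all instances, compared by
-- `Modal-mono`.
Modal : {a : ℕ} (t : ΣTree a) → Atom X → Pred (ΣTree.Node t) 0ℓ → Pred (ΣTree.Node t) 0ℓ
Modal t (◇ k _) P v = AtLeast k (λ v′ → ΣTree.Child t v v′ × P v′)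
Modal t (□ k _) P v = ∃ λ exceptions → length exceptions < k
  × (∀ v′ → ΣTree.Child t v v′ → ¬ (v′ ∈ₗ exceptions) → P v′)
Modal t (⇑ _)   P v = ∃ λ v′ → ΣTree.Child t v′ v × P v′

Modal-mono : {a : ℕ} (t : ΣTree a) (α : Atom X) {P Q : Pred (ΣTree.Node t) 0ℓ} →
             (∀ v → P v → Q v) → ∀ {v} → Modal t α P v → Modal t α Q v
Modal-mono t (◇ k _) {P} f m          =
  AtLeast-mono {P = λ v′ → ΣTree.Child t _ v′ × P v′} (λ v (c , p) → c , f v p) m
Modal-mono t (□ k _) f (xs , few , m) = xs , few , λ v c v∉ → f v (m v c v∉)
Modal-mono t (⇑ _)   f (v , c , m)    = v , c , f v m

-- Semantics of the derived connectives

module Semantics (em : ExcludedMiddle 0ℓ) {a : ℕ} (p₀ : Fin a) (t : ΣTree a) where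
  open ΣTree t
  open Connectives p₀

  trueᶠ-holds : ∀ u → Sat t trueᶠ u
  trueᶠ-holds u with em {Sat t (var p₀) u}
  ... | yes p = inj₁ p
  ... | no ¬p = inj₂ ¬p

  and-sat : ∀ φ ψ {u} → Sat t (φ and ψ) u ⇔ (Sat t φ u × Sat t ψ u)
  and-sat φ ψ = mk⇔
    (λ s → decidable-stable em (s ∘ inj₁) , decidable-stable em (s ∘ inj₂))
    (λ { (x , y) (inj₁ ¬x) → ¬x x ; (x , y) (inj₂ ¬y) → ¬y y })

  ite-yes : ∀ φ ψ χ {u} → Sat t φ u → Sat t (ite φ ψ χ) u ⇔ Sat t ψ u
  ite-yes φ ψ χ s = mk⇔
    (λ { (inj₁ x) → proj₂ (to (and-sat φ ψ) x)
       ; (inj₂ y) → contradiction s (proj₁ (to (and-sat (not φ) χ) y)) })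
    (λ x → inj₁ (from (and-sat φ ψ) (s , x)))

  ite-no : ∀ φ ψ χ {u} → ¬ Sat t φ u → Sat t (ite φ ψ χ) u ⇔ Sat t χ u
  ite-no φ ψ χ ¬s = mk⇔
    (λ { (inj₁ x) → contradiction (proj₁ (to (and-sat φ ψ) x)) ¬s
       ; (inj₂ y) → proj₂ (to (and-sat (not φ) χ) y) })
    (λ x → inj₂ (from (and-sat (not φ) χ) (¬s , x)))

  caseLabel-sat : ∀ {m} (ι : Fin m → Fin a) f {u} →
    Sat t (caseLabel ι f) u ⇔ Sat t (f (tabulateᵛ (lookup (label u) ∘ ι))) u
  caseLabel-sat {zero}  ι f = mk⇔ id id
  caseLabel-sat {suc m} ι f {u} with lookup (label u) (ι zero) in eq
  ... | true  = caseLabel-sat (ι ∘ suc) (f ∘ (inside ∷_)) ⇔-∘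
                ite-yes (var (ι zero)) _ _ (lookup⇒[]= (ι zero) (label u) eq)
  ... | false = caseLabel-sat (ι ∘ suc) (f ∘ (outside ∷_)) ⇔-∘
                ite-no (var (ι zero)) _ _ λ p →
                  contradiction (trans (sym eq) ([]=⇒lookup p)) λ ()

  position-child : ∀ {u v} → Child v u → position rootedTree u ≡ nonRoot
  position-child c rewrite c = refl

  position-orphan : ∀ {u} → parent u ≡ nothing → position rootedTree u ≡ atRoot
  position-orphan eq rewrite eq = refl

  casePosition-sat : ∀ (f : Position → PastCTL± a) {u} →
    Sat t (ite (EY trueᶠ) (f nonRoot) (f atRoot)) u ⇔ Sat t (f (position rootedTree u)) u
  casePosition-sat f {u} = go (parent u) refl
    where
    go : ∀ m → parent u ≡ m →
         Sat t (ite (EY trueᶠ) (f nonRoot) (f atRoot)) u ⇔ Sat t (f (position rootedTree u)) u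
    go (just v) c rewrite position-child c =
      ite-yes (EY trueᶠ) (f nonRoot) (f atRoot) (v , c , trueᶠ-holds v)
    go nothing eq rewrite position-orphan eq =
      ite-no (EY trueᶠ) (f nonRoot) (f atRoot) λ (v , c , _) →
        contradiction (trans (sym eq) c) λ ()

  caseNode-sat : ∀ f {u} →
    Sat t (caseNode f) u ⇔ Sat t (f (label u) (position rootedTree u)) u
  caseNode-sat f {u} =
    subst (λ σ → Sat t (caseNode f) u ⇔ Sat t (f σ (position rootedTree u)) u)
      (tabulate∘lookup (label u))
      (casePosition-sat (f (tabulateᵛ (lookup (label u)))) ⇔-∘
       caseLabel-sat id λ σ → ite (EY trueᶠ) (f σ nonRoot) (f σ atRoot))

  -- For `□ k`, the children violating `φ` fit into a list of fewer than `k` exceptions exactly when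
  -- there are not `k` distinct ones.
  modal-sat : ∀ (α : Atom X) φ {u} → Sat t (modal α φ) u ⇔ Modal t α (Sat t φ) u
  modal-sat (◇ k _) φ = mk⇔ id id
  modal-sat (□ k _) φ = mk⇔
    (λ few → let xs , xs<k , bad⊆xs = ¬AtLeast⇒listed em k few in
      xs , xs<k , λ v c v∉ → decidable-stable em λ ¬s → v∉ (bad⊆xs v (c , ¬s)))
    (λ (xs , xs<k , good) → listed⇒¬AtLeast {P = λ v → Child _ v × ¬ Sat t φ v} xs xs<k
      λ v (c , ¬s) → decidable-stable em λ v∉ → ¬s (good v c v∉))
  modal-sat (⇑ _)   φ = mk⇔ id id

  interpret-sat : ∀ (g : X → PastCTL± a) θ {u} →
    Sat t (interpret g θ) u ⇔ eval (λ x → Sat t (g x) u) θ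
  interpret-sat g tt       = mk⇔ (λ _ → ∗) (λ _ → trueᶠ-holds _)
  interpret-sat g ff       = mk⇔ (λ s → s (trueᶠ-holds _)) ⊥-elim
  interpret-sat g (atom x) = mk⇔ id id
  interpret-sat g (θ ∧ η)  = mk⇔
    (λ s → let x , y = to (and-sat (interpret g θ) (interpret g η)) s in
      to (interpret-sat g θ) x , to (interpret-sat g η) y)
    (λ (x , y) → from (and-sat (interpret g θ) (interpret g η))
      (from (interpret-sat g θ) x , from (interpret-sat g η) y))
  interpret-sat g (θ ∨ η)  = mk⇔
    (map-⊎ (to (interpret-sat g θ)) (to (interpret-sat g η)))
    (map-⊎ (from (interpret-sat g θ)) (from (interpret-sat g η)))

-- The formula of an automaton

module Translation {a : ℕ} (A : HTA± a) (p₀ : Fin a) where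
  open HTA± A
  open Connectives p₀

  substitute : State → PastCTL± a → (State → PastCTL± a) → Atom State → PastCTL± a
  substitute q β φ α with stateOf α ≟ q
  ... | yes _ = β
  ... | no _  = modal α (φ (stateOf α))

  δᶠ : State → PastCTL± a → (State → PastCTL± a) → PastCTL± a
  δᶠ q β φ = caseNode λ σ ρ → interpret (substitute q β φ) (δ q σ ρ)

  -- The universal clause is the release formula A(`δ⊥` R `δ⊤`): on every path `δ⊤` holds up to and
  -- including the first node with `δ⊥`, and forever if there is none. It is a greatest fixpoint,
  -- while the existential clause is a least one.
  fixpoint : Kind → PastCTL± a → PastCTL± a → PastCTL± a
  fixpoint transient   δ⊤ δ⊥ = δ⊥
  fixpoint existential δ⊤ δ⊥ = E δ⊤ U δ⊥
  fixpoint universal   δ⊤ δ⊥ = not (E (not δ⊥) U (not δ⊤))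
  fixpoint upward      δ⊤ δ⊥ = E δ⊤ S δ⊥

  -- Meaningful only if the component of the state is below the first argument.
  formula : ℕ → State → PastCTL± a
  formula zero    q = falseᶠ
  formula (suc n) q =
    fixpoint (kind (component q)) (δᶠ q trueᶠ (formula n)) (δᶠ q falseᶠ (formula n))

-- Unravelling of a graph

module Unravelling {C : Set} (Step : C → C → Set) (c₀ : C) where

  -- The history is part of a node of the unravelling, so a configuration reached in several ways
  -- gives several nodes, each with one parent.
  data Reach : C → Set where
    start : Reach c₀
    _▷_   : ∀ {c c′} → Reach c → Step c c′ → Reach c′

  predecessor : Σ C Reach → Maybe (Σ C Reach)
  predecessor (_ , start)          = nothing
  predecessor (_ , _▷_ {c = c} r s) = just (c , r)

  unravelling : RootedTree
  unravelling = record
    { Node        = Σ C Reach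
    ; root        = c₀ , start
    ; parent      = predecessor
    ; parent-root = refl
    ; ascent      = λ (_ , r) → ascend r
    }
    where
    ascend : ∀ {c} (r : Reach c) →
             Star (λ x y → predecessor x ≡ just y) (c , r) (c₀ , start)
    ascend start   = ε
    ascend (r ▷ s) = refl ◅ ascend r

  child⇒step : ∀ x y → RootedTree.Child unravelling x y → Step (proj₁ x) (proj₁ y)
  child⇒step _ (_ , (r ▷ s)) refl = s

-- Correctness of the translation

module Correctness (em : ExcludedMiddle 0ℓ) {a : ℕ} (p₀ : Fin a)
                   (A : HTA± a) (linear : Linear A) (t : ΣTree a) where
  open HTA± A
  private module t = ΣTree t
  open Connectives p₀
  open Semantics em p₀ t
  open Translation A p₀

  δAt : State → t.Node → B⁺ (Atom State)
  δAt q v = δ q (t.label v) (position t.rootedTree v)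

  -- By linearity distinct states have distinct components, so the order on components is strict
  -- here. This makes recursion on the bound possible.
  occurs-lower : ∀ {q v α n} → α OccursIn δAt q v → stateOf α ≢ q →
                 toℕ (component q) < suc n → toℕ (component (stateOf α)) < n
  occurs-lower {q} {v} {α} o α≢q q<n = <-≤-trans
    (≤∧≢⇒< (ordered q _ _ α o) (α≢q ∘ linear ∘ toℕ-injective)) (s≤s⁻¹ q<n)

  module _ {q : State} {φ : State → PastCTL± a} {v : t.Node} {W : Pred (Atom State) 0ℓ} where

    private
      NonSelf Self : Atom State → Set
      NonSelf α = Modal t α (Sat t (φ (stateOf α))) v
      Self α    = stateOf α ≡ q

      δᶠ-sat : ∀ β → Sat t (δᶠ q β φ) v ⇔
                     eval (λ α → Sat t (substitute q β φ α) v) (δAt q v)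
      δᶠ-sat β = interpret-sat (substitute q β φ) (δAt q v) ⇔-∘
                 caseNode-sat (λ σ ρ → interpret (substitute q β φ) (δ q σ ρ))

    δᶠ-true-elim : Sat t (δᶠ q trueᶠ φ) v →
      (∀ α → α OccursIn δAt q v → stateOf α ≢ q → NonSelf α → W α) →
      (∀ α → α OccursIn δAt q v → Self α → W α) →
      eval W (δAt q v)
    δᶠ-true-elim s other self = eval-mono (δAt q v) step (to (δᶠ-sat trueᶠ) s)
      where
      step : ∀ α → α OccursIn δAt q v → Sat t (substitute q trueᶠ φ α) v → W α
      step α o s with stateOf α ≟ q
      ... | yes α≡q = self α o α≡q
      ... | no α≢q  = other α o α≢q (to (modal-sat α _) s)

    δᶠ-false-elim : Sat t (δᶠ q falseᶠ φ) v →
      (∀ α → α OccursIn δAt q v → stateOf α ≢ q → NonSelf α → W α) →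
      eval W (δAt q v)
    δᶠ-false-elim s other = eval-mono (δAt q v) step (to (δᶠ-sat falseᶠ) s)
      where
      step : ∀ α → α OccursIn δAt q v → Sat t (substitute q falseᶠ φ α) v → W α
      step α o s with stateOf α ≟ q
      ... | yes _  = contradiction (trueᶠ-holds v) s
      ... | no α≢q = other α o α≢q (to (modal-sat α _) s)

    -- Setting self atoms to true can only help, which gives the first part. Setting them to false
    -- does harm only if the evaluation used one, and that one is returned.
    δᶠ-intro :
      (∀ α → α OccursIn δAt q v → stateOf α ≢ q → W α → NonSelf α) →
      eval W (δAt q v) →
      Sat t (δᶠ q trueᶠ φ) v
      × (Sat t (δᶠ q falseᶠ φ) v ⊎ ∃ λ α → α OccursIn δAt q v × Self α × W α)
    δᶠ-intro other e =
      from (δᶠ-sat trueᶠ) (eval-mono (δAt q v) step⊤ e) ,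
      map-⊎ (from (δᶠ-sat falseᶠ)) id (eval-mono-or-occurs (δAt q v) step⊥ e)
      where
      step⊤ : ∀ α → α OccursIn δAt q v → W α → Sat t (substitute q trueᶠ φ α) v
      step⊤ α o w with stateOf α ≟ q
      ... | yes _  = trueᶠ-holds v
      ... | no α≢q = from (modal-sat α _) (other α o α≢q w)

      step⊥ : ∀ α → α OccursIn δAt q v → W α →
              Sat t (substitute q falseᶠ φ α) v ⊎ Self α × W α
      step⊥ α o w with stateOf α ≟ q
      ... | yes α≡q = inj₂ (α≡q , w)
      ... | no α≢q  = inj₁ (from (modal-sat α _) (other α o α≢q w))

  SelfAtom : Kind → State → Atom State → Set
  SelfAtom transient   q α = ⊥
  SelfAtom existential q α = α ≡ ◇ 1 q
  SelfAtom universal   q α = α ≡ □ 1 q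
  SelfAtom upward      q α = α ≡ ⇑ q

  -- An atom about `q` lies in the component of `q`, so the hesitancy condition of its kind dictates
  -- its shape, or excludes it in the transient case.
  selfAtom : ∀ {q v α} → α OccursIn δAt q v → stateOf α ≡ q →
             SelfAtom (kind (component q)) q α
  selfAtom {q} {v} {α} o refl = go (kind (component q)) (hesitant (component q))
    where
    go : ∀ k → OfKind automaton component k (component q) → SelfAtom k q α
    go transient   h = h q _ _ refl α o refl
    go existential h = proj₁ (h q _ _ refl) α o refl
    go universal   h = proj₁ (h q _ _ refl) α o refl
    go upward (q₀ , unique , h) with refl ← to (unique q) refl = h _ _ α o refl

  -- From runs to formulae

  module FromRun (run : Run A t t.root) (accepting : Accepting A t run) where
    open Run run

    -- Both sides agree by definition, but only once the form of the atom is known.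
    atomSat⇒Modal : ∀ {x v} α → AtomSat A t tree runLabel x v α →
                    Modal t α (HasChild A t tree runLabel x (stateOf α)) v
    atomSat⇒Modal (◇ _ _) s = s
    atomSat⇒Modal (□ _ _) s = s
    atomSat⇒Modal (⇑ _)   s = s

    -- Acceptance concerns paths from the root of the run; a path from `x` becomes one by prepending
    -- the ancestors of `x`.
    accepting-from : ∀ {x} → Star (flip Child) x root →
      (π : ℕ → Node) → π 0 ≡ x → (∀ n → Child (π n) (π (suc n))) →
      ∀ n → ∃ λ m → n ≤ m × proj₁ (runLabel (π m)) ∈ F
    accepting-from ε         π π0 steps n = accepting π π0 steps n
    accepting-from (_◅_ {j = y} c up) π refl steps n
      -- The prepended node shifts positions by one. Asking for a position of at least `suc n`
      -- excludes the new position 0.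
      with accepting-from up (λ { zero → y ; (suc k) → π k }) refl
             (λ { zero → c ; (suc k) → steps k }) (suc n)
    ... | suc m , s≤s n≤m , f = m , n≤m , f

    -- Iterating `next` from a node in `P` would give an infinite path of the run without any visit
    -- to `F`.
    no-path-avoiding-F : (P : Pred Node 0ℓ) →
      (∀ x → P x → ¬ proj₁ (runLabel x) ∈ F × ∃ λ y → Child x y × P y) →
      ∀ x → ¬ P x
    no-path-avoiding-F P next x px =
      let m , _ , f = accepting-from (ascent x) (proj₁ ∘ π) refl steps 0 in
      proj₁ (next _ (proj₂ (π m))) f
      where
      π : ℕ → Σ Node P
      π zero    = x , px
      π (suc n) = let y , _ , py = proj₂ (next _ (proj₂ (π n))) in y , py

      steps : ∀ n → Child (proj₁ (π n)) (proj₁ (π (suc n)))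
      steps n = proj₁ (proj₂ (proj₂ (next _ (proj₂ (π n)))))

    LabelsSatisfy : State → PastCTL± a → Set
    LabelsSatisfy q φ = ∀ x v → runLabel x ≡ (q , v) → Sat t φ v

    consistent-at : ∀ {x q v} → runLabel x ≡ (q , v) →
                    eval (AtomSat A t tree runLabel x v) (δAt q v)
    consistent-at {x} eq =
      subst (λ (q , v) → eval (AtomSat A t tree runLabel x v) (δAt q v)) eq (consistent x)

    module _ (q : State) (δ⊤ δ⊥ : PastCTL± a) where

      Unfolds : Kind → Set
      Unfolds k = ∀ x v → runLabel x ≡ (q , v) → Sat t δ⊤ v ×
        (Sat t δ⊥ v ⊎ ∃ λ α → SelfAtom k q α × Modal t α (HasChild A t tree runLabel x q) v)

      -- Existential: where the until fails, it fails again at a child in the run, giving a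
      -- forbidden path outside `F`. Universal: the run follows any finite path refuting the release
      -- formula to its end, where `δ⊤` holds after all. Upward: induction on the ancestor chain.
      fixpoint-sound : ∀ k → kind (component q) ≡ k → Unfolds k →
                       LabelsSatisfy q (fixpoint k δ⊤ δ⊥)
      fixpoint-sound transient _ unfold x v eq with proj₂ (unfold x v eq)
      ... | inj₁ s = s

      fixpoint-sound existential ke unfold x v eq =
        decidable-stable em λ ¬s →
          no-path-avoiding-F Bad next x (v , eq , ¬s)
        where
        Bad : Pred Node 0ℓ
        Bad x = ∃ λ v → runLabel x ≡ (q , v) × ¬ Sat t (E δ⊤ U δ⊥) v

        next : ∀ x → Bad x → ¬ proj₁ (runLabel x) ∈ F × ∃ λ y → Child x y × Bad y
        next x (v , eq , ¬s) =
          (λ f → existential∉F q ke (subst (λ l → proj₁ l ∈ F) eq f)) , successor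
          where
          successor : ∃ λ y → Child x y × Bad y
          successor with unfold x v eq
          ... | _ , inj₁ s⊥ = 
            contradiction (pathUntil-here t.Child (Sat t δ⊤) (Sat t δ⊥) s⊥) ¬s
          ... | s⊤ , inj₂ (_ , refl , w , _ , p)
            with c , y , c′ , eq′ ← p zero =
            y , c′ , w zero , eq′ , λ s → 
              ¬s (pathUntil-there t.Child (Sat t δ⊤) (Sat t δ⊥) s⊤ c s)

      fixpoint-sound universal _ unfold x v eq s =
        let j , u = pathUntil⇒after t.Child (Sat t (not δ⊥)) (Sat t (not δ⊤)) s in go j x v eq u
        where
        go : ∀ j x v → runLabel x ≡ (q , v) →
             ¬ UntilAfter t.Child (Sat t (not δ⊥)) (Sat t (not δ⊤)) j v
        go zero    x v eq ¬s⊤ = ¬s⊤ (proj₁ (unfold x v eq))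
        go (suc j) x v eq (¬s⊥ , v′ , c , u) with proj₂ (unfold x v eq)
        ... | inj₁ s⊥ = ¬s⊥ s⊥
        -- Fewer than one exception means none, so the run also sends `q` to the next node `v′` of
        -- the refuting path.
        ... | inj₂ (_ , refl , [] , _ , all)
          with y , _ , eq′ ← all v′ c (λ ()) = go j y v′ eq′ u
        ... | inj₂ (_ , refl , _ ∷ _ , s≤s () , _)

      fixpoint-sound upward _ unfold x v eq = go (t.ascent v) x eq
        where
        go : ∀ {v} → Star (flip t.Child) v t.root → ∀ x → runLabel x ≡ (q , v) →
             Sat t (E δ⊤ S δ⊥) v
        go {v} up x eq with unfold x v eq
        ... | _ , inj₁ s⊥ =
          pathUntil-here (flip t.Child) (Sat t δ⊤) (Sat t δ⊥) s⊥
        go ε x eq | s⊤ , inj₂ (_ , refl , v′ , c , _) =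
          contradiction (trans (sym t.parent-root) c) λ ()
        go (c₀ ◅ up) x eq | s⊤ , inj₂ (_ , refl , v′ , c , y , _ , eq′)
          -- Parents are unique, so the run moves along the chain on which `go` recurses.
          with refl ← trans (sym c₀) c =
          pathUntil-there (flip t.Child) (Sat t δ⊤) (Sat t δ⊥) s⊤ c (go up y eq′)

    formula-sound : ∀ n q → toℕ (component q) < n → LabelsSatisfy q (formula n q)
    formula-sound (suc n) q q<n =
      fixpoint-sound q _ _ (kind (component q)) refl λ x v eq →
        map₂ (map-⊎ id λ { (α , o , refl , s) → α , selfAtom o refl , atomSat⇒Modal α s })
          (δᶠ-intro
            (λ α o α≢q s → Modal-mono t α
              (λ { v′ (y , _ , eq′) →
                   formula-sound n (stateOf α) (occurs-lower o α≢q q<n) y v′ eq′ })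
              (atomSat⇒Modal α s))
            (consistent-at eq))

  -- From formulae to runs

  -- The number j counts the remaining steps in the state itself; it is not
  -- used where such steps are impossible or lead to acceptance.
  Evidence : Kind → PastCTL± a → PastCTL± a → ℕ → Pred t.Node 0ℓ
  Evidence transient   δ⊤ δ⊥ j v = Sat t δ⊥ v
  Evidence existential δ⊤ δ⊥ j v = UntilAfter t.Child (Sat t δ⊤) (Sat t δ⊥) j v
  Evidence universal   δ⊤ δ⊥ j v = Sat t (fixpoint universal δ⊤ δ⊥) v
  Evidence upward      δ⊤ δ⊥ j v = UntilAfter (flip t.Child) (Sat t δ⊤) (Sat t δ⊥) j v

  evidence : ∀ k {δ⊤ δ⊥ v} → Sat t (fixpoint k δ⊤ δ⊥) v → ∃ λ j → Evidence k δ⊤ δ⊥ j v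
  evidence transient   s = 0 , s
  evidence existential s = pathUntil⇒after t.Child _ _ s
  evidence universal   s = 0 , s
  evidence upward      s = pathUntil⇒after (flip t.Child) _ _ s

  EvidenceAt : ℕ → State → ℕ → Pred t.Node 0ℓ
  EvidenceAt n q =
    Evidence (kind (component q)) (δᶠ q trueᶠ (formula n)) (δᶠ q falseᶠ (formula n))

  -- A node of the run to be built, with evidence for `formula (suc level) state`. The level stays
  -- fixed while the state does and drops when the state changes; the rank counts steps within the
  -- state.
  record Configuration : Set where
    constructor config
    field
      {level}    : ℕ
      state      : State
      node       : t.Node
      {rank}     : ℕ
      bounded    : toℕ (component state) < suc level
      justified  : EvidenceAt level state rank node

  open Configuration

  -- The equation on levels records that a configuration obtained from `formula n` lies strictly
  -- below level `n`.
  toConfiguration : ∀ n q v → toℕ (component q) < n → Sat t (formula n q) v →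
    ∃ λ c → (state c , node c) ≡ (q , v) × suc (level c) ≡ n
  toConfiguration (suc n) q v q<n s =
    config q v q<n (proj₂ (evidence (kind (component q)) s)) , refl , refl

  _≺_ : ℕ × ℕ → ℕ × ℕ → Set
  _≺_ = ×-Lex _≡_ _<_ _<_

  ≺-wellFounded : WellFounded _≺_
  ≺-wellFounded = ×-wellFounded <-wellFounded <-wellFounded

  measure : Configuration → ℕ × ℕ
  measure c = level c , rank c

  -- A decreasing measure outside F forces infinitely many visits to F, so that
  -- an F-state may be left in any way at all.
  Step : Configuration → Configuration → Set
  Step c c′ = state c ∈ F ⊎ measure c′ ≺ measure c

  -- Until a visit to `F`, each step decreases the well-founded lexicographic measure.
  reaches-F : (π : ℕ → Configuration) → (∀ n → Step (π n) (π (suc n))) →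
              ∃ λ m → state (π m) ∈ F
  reaches-F π steps = go π steps (≺-wellFounded (measure (π 0)))
    where
    go : (π : ℕ → Configuration) → (∀ n → Step (π n) (π (suc n))) →
         Acc _≺_ (measure (π 0)) → ∃ λ m → state (π m) ∈ F
    go π steps (acc rec) with steps 0
    ... | inj₁ f  = 0 , f
    ... | inj₂ lt with m , f ← go (π ∘ suc) (steps ∘ suc) (rec lt) = suc m , f

  Successor : Configuration → State → t.Node → Set
  Successor c q v = ∃ λ c′ → Step c c′ × (state c′ , node c′) ≡ (q , v)

  SuccessorSat : Configuration → Atom State → Set
  SuccessorSat c α = Modal t α (Successor c (stateOf α)) (node c)

  module _ (c : Configuration) where
    private
      q = state c
      v = node c
      δ⊤ = δᶠ q trueᶠ (formula (level c))
      δ⊥ = δᶠ q falseᶠ (formula (level c))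

    other-successors : ∀ α → α OccursIn δAt q v → stateOf α ≢ q →
      Modal t α (Sat t (formula (level c) (stateOf α))) v → SuccessorSat c α
    other-successors α o α≢q = Modal-mono t α λ v′ s →
      let c′ , eq , lv = toConfiguration _ _ v′ (occurs-lower o α≢q (bounded c)) s in
      c′ , inj₂ (inj₁ (≤-reflexive lv)) , eq

    stop : Sat t δ⊥ v → eval (SuccessorSat c) (δAt q v)
    stop s = δᶠ-false-elim s other-successors

    continue : Sat t δ⊤ v →
      (∀ α → SelfAtom (kind (component q)) q α → Modal t α (Successor c q) v) →
      eval (SuccessorSat c) (δAt q v)
    continue s self = δᶠ-true-elim s other-successors λ
      { α o refl → self α (selfAtom o refl) }

    -- The kind is generalised to `k` so that it can be split on; `continue` is therefore passed in
    -- as `go`, because its type mentions the kind. The argument `self` allows a step within `q`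
    -- when `q` is in `F` or the rank decreases.
    locally-consistent : ∀ k j → kind (component q) ≡ k → Evidence k δ⊤ δ⊥ j v →
      (∀ v′ j′ → Evidence k δ⊤ δ⊥ j′ v′ → q ∈ F ⊎ j′ < j → Successor c q v′) →
      (Sat t δ⊤ v → (∀ α → SelfAtom k q α → Modal t α (Successor c q) v) →
        eval (SuccessorSat c) (δAt q v)) →
      eval (SuccessorSat c) (δAt q v)
    locally-consistent transient   j       _ s self go = stop s
    locally-consistent existential zero    _ s self go = stop s
    locally-consistent existential (suc j) _ (s⊤ , v′ , ch , u) self go =
      go s⊤ λ { _ refl → (λ _ → v′) , (λ { {zero} {zero} _ → refl }) ,
                         λ _ → ch , self v′ j u (inj₂ (n<1+n j)) }
    locally-consistent upward      zero    _ s self go = stop s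
    locally-consistent upward      (suc j) _ (s⊤ , v′ , ch , u) self go =
      go s⊤ λ { _ refl → v′ , ch , self v′ j u (inj₂ (n<1+n j)) }
    locally-consistent universal   j       ku s self go with em {Sat t δ⊥ v}
    ... | yes s⊥ = stop s⊥
    ... | no ¬s⊥ =
      -- If `δ⊤` failed here, the path of length 0 would refute the release formula.
      go (decidable-stable em
           (s ∘ pathUntil-here t.Child (Sat t (not δ⊥)) (Sat t (not δ⊤)))) λ { _ refl →
        [] , s≤s z≤n , λ v′ ch _ →
          -- A refuting path from the child would extend to one from `v`, as `δ⊥` fails at `v`.
          -- Universal states are in `F`, so no descent is required and the rank takes the default
          -- value 0.
          self v′ 0 (s ∘ pathUntil-there t.Child (Sat t (not δ⊥)) (Sat t (not δ⊤)) ¬s⊥ ch)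
            (inj₁ (universal∈F q ku)) }

    successors : eval (SuccessorSat c) (δAt q v)
    successors = locally-consistent (kind (component q)) (rank c) refl (justified c)
      (λ v′ j′ e → λ { (inj₁ f)  → config q v′ (bounded c) e , inj₁ f , refl
                     ; (inj₂ lt) → config q v′ (bounded c) e , inj₂ (inj₂ (refl , lt)) , refl })
      continue

  module ToRun (c₀ : Configuration) (start≡ : (state c₀ , node c₀) ≡ (qI , t.root)) where
    open Unravelling Step c₀

    labelling : Σ Configuration Reach → State × t.Node
    labelling (c , _) = state c , node c

    successor⇒atomSat : ∀ x α → SuccessorSat (proj₁ x) α →
      AtomSat A t unravelling labelling x (node (proj₁ x)) α
    successor⇒atomSat (c , r) α s = go α (Modal-mono t α child s)
      where
      HasChild′ : State → t.Node → Set
      HasChild′ = HasChild A t unravelling labelling (c , r)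

      child : ∀ v → Successor c (stateOf α) v → HasChild′ (stateOf α) v
      child v (c′ , st , eq) = (c′ , r ▷ st) , refl , eq

      go : ∀ α → Modal t α (HasChild′ (stateOf α)) (node c) →
           AtomSat A t unravelling labelling (c , r) (node c) α
      go (◇ _ _) m = m
      go (□ _ _) m = m
      go (⇑ _)   m = m

    run : Run A t t.root
    run = record
      { tree       = unravelling
      ; runLabel   = labelling
      ; rootLabel  = start≡
      ; consistent = λ x@(c , _) →
          eval-mono (δAt (state c) (node c)) (λ α _ → successor⇒atomSat x α) (successors c)
      }

    run-accepting : Accepting A t run
    run-accepting π _ steps n
      -- Applied to the suffix of the path from position `n`, this gives a visit to `F` at or after
      -- `n`.
      with m , f ← reaches-F (λ k → proj₁ (π (n + k)))
                     (λ k → child⇒step (π (n + k)) (π (n + suc k))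
                       (subst (λ i → RootedTree.Child unravelling (π (n + k)) (π i))
                         (sym (+-suc n k)) (steps (n + k)))) =
      n + m , m≤m+n n m , f

-- Equality of the two languages

theorem5p1 : ExcludedMiddle 0ℓ →
    (a : ℕ) → .{{NonZero a}} →
    (A : HTA± a) → Linear A →
    ∃ λ (φ : PastCTL± a) → L-automaton A ≐ L-formula φ
theorem5p1 em (suc a) A linear = φ , sound , complete
  where
  open HTA± A
  -- As there is at least one proposition, the first can serve as `p₀`.
  open Translation A zero

  φ : PastCTL± (suc a)
  -- Every component index is below `#components`, so this depth is enough for the initial state.
  φ = formula #components qI

  sound : ∀ {t} → L-automaton A t → L-formula φ t
  sound {t} (run , accepting) =
    formula-sound #components qI (toℕ<n (component qI)) _ _ (Run.rootLabel run)
    where open Correctness.FromRun em zero A linear t run accepting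

  complete : ∀ {t} → L-formula φ t → L-automaton A t
  complete {t} s
    with c₀ , eq , _ ← Correctness.toConfiguration em zero A linear t
                         #components qI _ (toℕ<n (component qI)) s =
    run , run-accepting
    where open Correctness.ToRun em zero A linear t c₀ eq
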